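{- Let $P$ be a finite poset, let $n\ge 4$ be odd, and assume $\frac{|P|+h(P)}{2}$ is an integer. Let $\mathcal{F}$ be an intersecting $P$-free family of subsets of $[n]$. Then \[ |\mathcal{F}|\le \sum_{i=1}^{\frac{|P|+h(P)}{2}-1}\binom{n}{\lfloor n/2\rfloor+i}. \]
   Context: $[n]=\{1,\dots,n\}$. A family is intersecting if any two of its members have nonempty intersection. A poset $P$ is a subposet of a poset $Q$ if there is an injection $\phi:P\to Q$ such that $x\le y$ in $P$ implies $\phi(x)\le\phi(y)$ in $Q$ (the converse is not required). A family $\mathcal{F}$ of sets, viewed as a poset under inclusion, is $P$-free if it does not contain $P$ as a subposet. $h(P)$ is the height of $P$, i.e. the size of a longest chain in $P$. -}

module Defs where

open import Level using (0ℓ)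
open import Data.Nat using (ℕ; zero; suc; _+_; _*_; _/_; _≤_)
open import Data.Nat.Combinatorics using (_C_)
open import Data.Fin using (Fin)
open import Data.Fin.Subset using (Subset; _⊆_; _∩_; Nonempty)
open import Data.List using (List; length; lookup)
open import Data.List.Relation.Unary.Unique.Propositional using (Unique)
open import Data.List.Membership.Propositional using (_∈_)
open import Data.Product using (Σ; _×_)
open import Data.Sum using (_⊎_)
open import Function.Definitions using (Injective)
open import Relation.Binary.PropositionalEquality using (_≡_)
open import Relation.Nullary using (¬_)
open import Relation.Binary.Structures using (IsPartialOrder)

record FinPoset : Set₁ where
  field
    size  : ℕ
    _≤P_  : Fin size → Fin size → Set
    isPO  : IsPartialOrder _≡_ _≤P_
open FinPoset public

card : FinPoset → ℕ
card P = size P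

IsChain : (P : FinPoset) (k : ℕ) → (Fin k → Fin (size P)) → Set
IsChain P k c = Injective _≡_ _≡_ c ×
  (∀ i j → _≤P_ P (c i) (c j) ⊎ _≤P_ P (c j) (c i))

IsHeight : FinPoset → ℕ → Set
IsHeight P h = Σ (Fin h → Fin (size P)) (IsChain P h) ×
  (∀ k (c : Fin k → Fin (size P)) → IsChain P k c → k ≤ h)

-- A family of subsets of [n]: a duplicate-free list of subsets.
Family : ℕ → Set
Family n = List (Subset n)

Intersecting : ∀ {n} → Family n → Set
Intersecting F = ∀ {A B} → A ∈ F → B ∈ F → Nonempty (A ∩ B)

-- P is a subposet of F: an injection φ from P into F (indices of the
-- duplicate-free list) with x ≤ y ⇒ φ x ⊆ φ y.
ContainsP : ∀ {n} → FinPoset → Family n → Set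
ContainsP P F = Σ (Fin (size P) → Fin (length F)) λ φ →
  Injective _≡_ _≡_ φ ×
  (∀ x y → _≤P_ P x y → lookup F (φ x) ⊆ lookup F (φ y))

PFree : ∀ {n} → FinPoset → Family n → Set
PFree P F = ¬ ContainsP P F

sumFrom1 : ℕ → (ℕ → ℕ) → ℕ
sumFrom1 zero    f = 0
sumFrom1 (suc K) f = sumFrom1 K f + f (suc K)

boundSum : ℕ → ℕ → ℕ
boundSum n k = sumFrom1 (k Data.Nat.∸ 1) (λ i → n C (n / 2 + i))

{-# OPTIONS --safe #-}
module Submission where

-- Burcsi and Nagy's double chain method.  A double chain in the subsets of [n]
-- consists of a maximal chain A_0 ⊂ … ⊂ A_n together with the sets
-- M_i = A_(i−1) ∪ (A_(i+1) ∖ A_i).  Any |P| + h(P) − 1 of its members contain P: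
-- fill the h(P) rank layers of P one after another along the double chain; it
-- suffices to waste one set between consecutive layers.  So F meets every double
-- chain in at most |P| + h(P) − 2 sets, and averaging over all permutations of [n]
-- bounds Σ 1/C(n,|A|) over A ∈ F by (|P| + h(P))/2 − 1, where [n] and ∅ have only
-- half weight.  As F is intersecting, it contains at most one of A and ∁ A, so
-- sizes i and n − i together contribute at most C(n,i) sets; under these two
-- constraints |F| is largest for full levels just above the middle.

open import Defs
open import Data.Bool using (Bool; true; false; T; if_then_else_)
import Data.Bool.Properties as Bool
open import Data.Fin using (Fin; zero; suc; toℕ; fromℕ<; combine)
import Data.Fin.Properties as Fin
open import Data.Fin.Subset using (Subset; inside; outside; _⊆_; _⊂_; ∁; ∣_∣; ⊥)
  renaming (_∈_ to _∈ˢ_)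
open import Data.Fin.Subset.Properties using (⊥⊆; out⊆; in⊆in; drop-∷-⊆;
  ∣⊥∣≡0; ∣p∣≤n; ∣∁p∣≡n∸∣p∣; p⊆q⇒∣p∣≤∣q∣;
  p⊂q⇒∣p∣<∣q∣; x∈p∩q⁻; x∈∁p⇒x∉p)
open import Data.List using (length; []; _∷_)
import Data.List as List
open import Data.List.Membership.Propositional using (_∈_)
import Data.List.Membership.DecPropositional as DecMembership
import Data.List.Relation.Unary.All.Properties as All
open import Data.List.Relation.Unary.AllPairs using ([]; _∷_)
open import Data.List.Relation.Unary.Any using (index)
open import Data.List.Relation.Unary.Any.Properties using (lookup-index)
open import Data.List.Relation.Unary.Unique.Propositional using (Unique)
open import Data.Nat
open import Data.Nat.Combinatorics using (_C_; nCk≡n!/k![n-k]!;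
  k![n∸k]!∣n!; nCk+nC[k+1]≡[n+1]C[k+1])
open import Data.Nat.DivMod using (m*n/n≡m; m*[n/m]≡n; +-distrib-/-∣ʳ)
open import Data.Nat.Divisibility using (divides-refl)
open import Data.Nat.Properties
open import Data.Nat.Tactic.RingSolver using (solve-∀)
open import Data.Product using (Σ; ∃; _×_; _,_; proj₁; proj₂)
open import Data.Sum using (_⊎_; inj₁; inj₂; [_,_]′)
open import Data.Unit using (⊤)
open import Data.Vec using ([]; _∷_; here; lookup; removeAt; insertAt; tabulate)
open import Data.Vec.Properties using (∷-injectiveˡ; ∷-injectiveʳ; insertAt-removeAt;
  lookup∘tabulate; lookup⇒[]=; []=⇒lookup; ≡-dec)
open import Function using (_∘_; id)
open import Relation.Binary.PropositionalEquality
open import Relation.Binary.Definitions using (tri<; tri≈; tri>)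
open import Relation.Binary.Structures using (IsPartialOrder)
open import Relation.Nullary using (¬_; Dec; yes; no; does; contradiction; ¬?)
open import Relation.Nullary.Decidable using (decidable-stable; ¬¬-excluded-middle; _×-dec_; dec-true)
open import Algebra.Properties.Semiring.Sum +-*-semiring using (sum; sum-cong-≗; ∑-distrib-+)

private
  variable
    n p h : ℕ

-- Finite sums over initial segments of the natural numbers.

sumTo : ℕ → (ℕ → ℕ) → ℕ
sumTo zero    f = 0
sumTo (suc N) f = f 0 + sumTo N (f ∘ suc)

sumTo-cong : ∀ N {f g} → (∀ i → i < N → f i ≡ g i) → sumTo N f ≡ sumTo N g
sumTo-cong zero    eq = refl
sumTo-cong (suc N) eq = cong₂ _+_ (eq 0 z<s) (sumTo-cong N λ i i<N → eq (suc i) (s<s i<N))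

sumTo-mono : ∀ N {f g} → (∀ i → i < N → f i ≤ g i) → sumTo N f ≤ sumTo N g
sumTo-mono zero    le = z≤n
sumTo-mono (suc N) le = +-mono-≤ (le 0 z<s) (sumTo-mono N λ i i<N → le (suc i) (s<s i<N))

+-interchange : ∀ a b c d → (a + b) + (c + d) ≡ (a + c) + (b + d)
+-interchange = solve-∀

sumTo-+ : ∀ N f g → sumTo N (λ i → f i + g i) ≡ sumTo N f + sumTo N g
sumTo-+ zero    f g = refl
sumTo-+ (suc N) f g =
  trans (cong (f 0 + g 0 +_) (sumTo-+ N (f ∘ suc) (g ∘ suc)))
        (+-interchange (f 0) (g 0) _ _)

sumTo-*ˡ : ∀ N c f → sumTo N (λ i → c * f i) ≡ c * sumTo N f
sumTo-*ˡ zero    c f = sym (*-zeroʳ c)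
sumTo-*ˡ (suc N) c f =
  trans (cong (c * f 0 +_) (sumTo-*ˡ N c (f ∘ suc))) (sym (*-distribˡ-+ c (f 0) _))

sumTo-const : ∀ N c → sumTo N (λ _ → c) ≡ N * c
sumTo-const zero    c = refl
sumTo-const (suc N) c = cong (c +_) (sumTo-const N c)

sumTo-split : ∀ M N f → sumTo (M + N) f ≡ sumTo M f + sumTo N (λ i → f (M + i))
sumTo-split zero    N f = refl
sumTo-split (suc M) N f =
  trans (cong (f 0 +_) (sumTo-split M N (f ∘ suc))) (sym (+-assoc (f 0) _ _))

sumTo-last : ∀ N f → sumTo (suc N) f ≡ sumTo N f + f N
sumTo-last zero    f = +-comm (f 0) 0
sumTo-last (suc N) f =
  trans (cong (f 0 +_) (sumTo-last N (f ∘ suc))) (sym (+-assoc (f 0) _ _))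

term≤sumTo : ∀ N f i → i < N → f i ≤ sumTo N f
term≤sumTo (suc N) f zero    _         = m≤m+n (f 0) _
term≤sumTo (suc N) f (suc i) (s≤s i<N) =
  ≤-trans (term≤sumTo N (f ∘ suc) i i<N) (m≤n+m _ (f 0))

sumFrom1≡sumTo : ∀ N f → sumFrom1 N f ≡ sumTo N (f ∘ suc)
sumFrom1≡sumTo zero    f = refl
sumFrom1≡sumTo (suc N) f =
  trans (cong (_+ f (suc N)) (sumFrom1≡sumTo N f)) (sym (sumTo-last N (f ∘ suc)))

-- Pairs the sizes 0, ..., 2t + 1 with their complements around the middle; the induction peels off
-- the outermost pair.
sumTo-fold : ∀ t f →
  sumTo (suc t * 2) f ≡ sumTo (suc t) (λ j → f (suc t + j) + f (t ∸ j))
sumTo-fold zero    f = solve-swap (f 0) (f 1)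
  where
  solve-swap : ∀ a b → a + (b + 0) ≡ b + a + 0
  solve-swap = solve-∀
sumTo-fold (suc t) f = begin
  f 0 + sumTo (suc (suc t * 2)) (f ∘ suc)
    ≡⟨ cong (f 0 +_) (sumTo-last (suc t * 2) (f ∘ suc)) ⟩
  f 0 + (sumTo (suc t * 2) (f ∘ suc) + f (3 + t * 2))
    ≡⟨ cong₂ (λ a b → f 0 + (a + f b)) (sumTo-fold t (f ∘ suc)) (top t) ⟩
  f 0 + (sumTo (suc t) (λ j → f (suc (suc t + j)) + f (suc (t ∸ j))) + f (suc (suc t) + suc t))
    ≡⟨ rotate (f 0) (sumTo (suc t) λ j → f (suc (suc t + j)) + f (suc (t ∸ j))) _ ⟩
  sumTo (suc t) (λ j → f (suc (suc t + j)) + f (suc (t ∸ j))) + (f (suc (suc t) + suc t) + f 0)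
    ≡⟨ cong₂ _+_ (sumTo-cong (suc t) λ j j≤t → cong (λ i → f (suc (suc t + j)) + f i) (sym (+-∸-assoc 1 (s≤s⁻¹ j≤t))))
                 (cong (λ i → f (suc (suc t) + suc t) + f i) (sym (n∸n≡0 (suc t)))) ⟩
  sumTo (suc t) (λ j → f (suc (suc t) + j) + f (suc t ∸ j)) + (f (suc (suc t) + suc t) + f (suc t ∸ suc t))
    ≡⟨ sumTo-last (suc t) (λ j → f (suc (suc t) + j) + f (suc t ∸ j)) ⟨
  sumTo (suc (suc t)) (λ j → f (suc (suc t) + j) + f (suc t ∸ j)) ∎
  where
  open ≡-Reasoning
  top : ∀ t → 3 + t * 2 ≡ suc (suc t) + suc t
  top = solve-∀
  rotate : ∀ a b c → a + (b + c) ≡ b + (c + a)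
  rotate = solve-∀

-- The sizes along the double chain are 0, 1, 1, 2, 2, ..., n - 1, n - 1, n: only the two extreme
-- ones occur once.
sumTo-adjacent : ∀ n (y : ℕ → ℕ) →
  sumTo (n * 2) (λ u → y ⌈ u /2⌉) ≡ sumTo n (λ i → y i + y (suc i))
sumTo-adjacent zero    y = refl
sumTo-adjacent (suc n) y =
  trans (cong (λ s → y 0 + (y 1 + s)) (sumTo-adjacent n (y ∘ suc))) (sym (+-assoc (y 0) _ _))

-- Permutations and their action on subsets.

-- Lehmer codes of permutations of n positions.
data Code : ℕ → Set where
  []  : Code 0
  _∷_ : Fin (suc n) → Code n → Code (suc n)

sumCode : (Code n → ℕ) → ℕ
sumCode {zero}  f = f []
sumCode {suc n} f = sum λ p → sumCode λ c → f (p ∷ c)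

sumCode-zero : ∀ n → sumCode {n} (λ _ → 0) ≡ 0
sumCode-zero zero    = refl
sumCode-zero (suc n) = trans (sum-cong-≗ {suc n} λ _ → sumCode-zero n) (sum-zero (suc n))
  where
  sum-zero : ∀ m → sum {m} (λ _ → 0) ≡ 0
  sum-zero zero    = refl
  sum-zero (suc m) = sum-zero m

sumCode-+ : (f g : Code n → ℕ) → sumCode (λ c → f c + g c) ≡ sumCode f + sumCode g
sumCode-+ {zero}  f g = refl
sumCode-+ {suc n} f g =
  trans (sum-cong-≗ λ p → sumCode-+ (f ∘ (p ∷_)) (g ∘ (p ∷_))) (∑-distrib-+ (λ p → sumCode (f ∘ (p ∷_))) (λ p → sumCode (g ∘ (p ∷_))))

sumTo-sumCode : ∀ N (f : ℕ → Code n → ℕ) →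
  sumTo N (λ u → sumCode (f u)) ≡ sumCode (λ c → sumTo N (λ u → f u c))
sumTo-sumCode {n} zero    f = sym (sumCode-zero n)
sumTo-sumCode     (suc N) f =
  trans (cong (sumCode (f 0) +_) (sumTo-sumCode N (f ∘ suc))) (sym (sumCode-+ (f 0) _))

sum-bounded : ∀ n b (f : Fin n → ℕ) → (∀ i → f i ≤ b) → sum f ≤ n * b
sum-bounded zero    b f f≤b = z≤n
sum-bounded (suc n) b f f≤b = +-mono-≤ (f≤b zero) (sum-bounded n b (f ∘ suc) (f≤b ∘ suc))

sumCode-bounded : ∀ b (f : Code n → ℕ) → (∀ c → f c ≤ b) → sumCode f ≤ n ! * b
sumCode-bounded {zero}  b f f≤b = ≤-trans (f≤b []) (m≤m+n b 0)
sumCode-bounded {suc n} b f f≤b = begin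
  sumCode f            ≤⟨ sum-bounded (suc n) (n ! * b) _ (λ p → sumCode-bounded b _ (f≤b ∘ (p ∷_))) ⟩
  suc n * (n ! * b)    ≡⟨ *-assoc (suc n) (n !) b ⟨
  suc n ! * b          ∎
  where open ≤-Reasoning

-- Each code entry selects one of the positions still left, so the characteristic vector of `q` is
-- read off in the permuted order.
permute : Code n → Subset n → Subset n
permute []      q = []
permute (p ∷ c) q = lookup q p ∷ permute c (removeAt q p)

∷-mono-⊆ : ∀ {s t} {q q′ : Subset n} → (s ≡ inside → t ≡ inside) → q ⊆ q′ → (s ∷ q) ⊆ (t ∷ q′)
∷-mono-⊆ {s = outside} s⇒t q⊆q′ = out⊆ q⊆q′
∷-mono-⊆ {s = inside}  s⇒t q⊆q′ with refl ← s⇒t refl = in⊆in q⊆q′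

removeAt-mono-⊆ : ∀ {q q′ : Subset (suc n)} p → q ⊆ q′ → removeAt q p ⊆ removeAt q′ p
removeAt-mono-⊆ {q = _ ∷ _}     {_ ∷ _}     zero    q⊆q′ = drop-∷-⊆ q⊆q′
removeAt-mono-⊆ {q = s ∷ _ ∷ _} {t ∷ _ ∷ _} (suc p) q⊆q′ =
  ∷-mono-⊆ {s = s} {t} (λ { refl → []=⇒lookup (q⊆q′ here) }) (removeAt-mono-⊆ p (drop-∷-⊆ q⊆q′))

permute-mono-⊆ : (c : Code n) {q q′ : Subset n} → q ⊆ q′ → permute c q ⊆ permute c q′
permute-mono-⊆ []      q⊆q′ = id
permute-mono-⊆ (p ∷ c) {q} {q′} q⊆q′ =
  ∷-mono-⊆ (λ qp → []=⇒lookup (q⊆q′ (lookup⇒[]= p q qp)))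
           (permute-mono-⊆ c (removeAt-mono-⊆ p q⊆q′))

permute-injective : (c : Code n) {q q′ : Subset n} → permute c q ≡ permute c q′ → q ≡ q′
permute-injective []      {[]} {[]} _  = refl
permute-injective (p ∷ c) {q} {q′} eq = begin
  q                                        ≡⟨ insertAt-removeAt q p ⟨
  insertAt (removeAt q p) p (lookup q p)   ≡⟨ cong₂ (λ r s → insertAt r p s) (permute-injective c (∷-injectiveʳ eq)) (∷-injectiveˡ eq) ⟩
  insertAt (removeAt q′ p) p (lookup q′ p) ≡⟨ insertAt-removeAt q′ p ⟩
  q′                                       ∎
  where open ≡-Reasoning

-- Sums over one level of the subset lattice.

-- The sum of χ over all i-element subsets of [n], split by the first element as in Pascal's rule.
levelSum : ∀ n → ℕ → (Subset n → ℕ) → ℕ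
levelSum zero    zero    χ = χ []
levelSum zero    (suc i) χ = 0
levelSum (suc n) zero    χ = levelSum n zero (χ ∘ (outside ∷_))
levelSum (suc n) (suc i) χ = levelSum n (suc i) (χ ∘ (outside ∷_)) + levelSum n i (χ ∘ (inside ∷_))

levelSum-> : ∀ {n i} χ → n < i → levelSum n i χ ≡ 0
levelSum-> {zero}  {suc i} χ _         = refl
levelSum-> {suc n} {suc i} χ (s≤s n<i) = cong₂ _+_ (levelSum-> _ (m<n⇒m<1+n n<i)) (levelSum-> _ n<i)

levelSum-mono : ∀ n i {χ ψ} → (∀ q → χ q ≤ ψ q) → levelSum n i χ ≤ levelSum n i ψ
levelSum-mono zero    zero    le = le []
levelSum-mono zero    (suc i) le = z≤n
levelSum-mono (suc n) zero    le = levelSum-mono n zero (le ∘ (outside ∷_))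
levelSum-mono (suc n) (suc i) le =
  +-mono-≤ (levelSum-mono n (suc i) (le ∘ (outside ∷_))) (levelSum-mono n i (le ∘ (inside ∷_)))

levelSum-+ : ∀ n i χ ψ → levelSum n i (λ q → χ q + ψ q) ≡ levelSum n i χ + levelSum n i ψ
levelSum-+ zero    zero    χ ψ = refl
levelSum-+ zero    (suc i) χ ψ = refl
levelSum-+ (suc n) zero    χ ψ = levelSum-+ n zero _ _
levelSum-+ (suc n) (suc i) χ ψ =
  trans (cong₂ _+_ (levelSum-+ n (suc i) _ _) (levelSum-+ n i _ _))
        (+-interchange (levelSum n (suc i) (χ ∘ (outside ∷_))) _ _ _)

levelSum-one : ∀ n i → levelSum n i (λ _ → 1) ≡ n C i
levelSum-one zero    zero    = refl
levelSum-one zero    (suc i) = refl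
levelSum-one (suc n) zero    = levelSum-one n zero
levelSum-one (suc n) (suc i) =
  trans (cong₂ _+_ (levelSum-one n (suc i)) (levelSum-one n i))
        (trans (+-comm (n C suc i) (n C i)) (nCk+nC[k+1]≡[n+1]C[k+1] n i))

-- Complementation swaps the two branches of the recursion. At level 0 the branch that is missing
-- corresponds to one beyond the top level, which vanishes.
levelSum-∁ : ∀ n i j χ → i + j ≡ n → levelSum n i (χ ∘ ∁) ≡ levelSum n j χ
levelSum-∁ zero    zero    zero    χ eq = refl
levelSum-∁ (suc n) zero    (suc n) χ refl =
  trans (levelSum-∁ n 0 n (χ ∘ (inside ∷_)) refl)
        (sym (cong (_+ levelSum n n (χ ∘ (inside ∷_))) (levelSum-> {n} (χ ∘ (outside ∷_)) (n<1+n n))))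
levelSum-∁ (suc n) (suc i) zero    χ eq = begin
  levelSum n (suc i) (χ ∘ (inside ∷_) ∘ ∁) + levelSum n i (χ ∘ (outside ∷_) ∘ ∁)
    ≡⟨ cong₂ _+_ (levelSum-> {n} {suc i} _ (≤-reflexive (trans (sym eq) (cong suc (+-identityʳ i)))))
                 (levelSum-∁ n i 0 (χ ∘ (outside ∷_)) (suc-injective eq)) ⟩
  levelSum n 0 (χ ∘ (outside ∷_)) ∎
  where open ≡-Reasoning
levelSum-∁ (suc n) (suc i) (suc j) χ eq =
  trans (cong₂ _+_ (levelSum-∁ n (suc i) j (χ ∘ (inside ∷_)) (trans (sym (+-suc i j)) (suc-injective eq)))
                   (levelSum-∁ n i (suc j) (χ ∘ (outside ∷_)) (suc-injective eq)))
        (+-comm (levelSum n j (χ ∘ (inside ∷_))) _)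

-- Averaging over all permutations.

sum-lookup : (q : Subset n) (g : Bool → ℕ) →
  sum (λ p → g (lookup q p)) ≡ ∣ q ∣ * g inside + ∣ ∁ q ∣ * g outside
sum-lookup []            g = refl
sum-lookup (outside ∷ q) g =
  trans (cong (g outside +_) (sum-lookup q g)) (swap (g outside) (∣ q ∣ * g inside) _)
  where
  swap : ∀ a b c → a + (b + c) ≡ b + (a + c)
  swap = solve-∀
sum-lookup (inside  ∷ q) g =
  trans (cong (g inside +_) (sum-lookup q g)) (sym (+-assoc (g inside) _ _))

∣removeAt∣-inside : (q : Subset (suc n)) (p : Fin (suc n)) →
  lookup q p ≡ inside → ∣ q ∣ ≡ suc ∣ removeAt q p ∣
∣removeAt∣-inside (inside  ∷ q)           zero    refl = refl
∣removeAt∣-inside (outside ∷ q@(_ ∷ _))   (suc p) eq   = ∣removeAt∣-inside q p eq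
∣removeAt∣-inside (inside  ∷ q@(_ ∷ _))   (suc p) eq   = cong suc (∣removeAt∣-inside q p eq)

∣removeAt∣-outside : (q : Subset (suc n)) (p : Fin (suc n)) →
  lookup q p ≡ outside → ∣ q ∣ ≡ ∣ removeAt q p ∣
∣removeAt∣-outside (outside ∷ q)           zero    refl = refl
∣removeAt∣-outside (outside ∷ q@(_ ∷ _))   (suc p) eq   = ∣removeAt∣-outside q p eq
∣removeAt∣-outside (inside  ∷ q@(_ ∷ _))   (suc p) eq   = cong suc (∣removeAt∣-outside q p eq)

-- Exactly i! j! permutations carry `q` to a given i-element set. The induction conditions on the
-- first entry read: i choices give `inside`, j give `outside`.
sumCode-permute : (q : Subset n) (i j : ℕ) (χ : Subset n → ℕ) → ∣ q ∣ ≡ i → i + j ≡ n →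
  sumCode (λ c → χ (permute c q)) ≡ i ! * j ! * levelSum n i χ
sumCode-permute {zero}  q zero zero χ _ _ = sym (+-identityʳ _)
sumCode-permute {suc n} q i j χ ∣q∣≡i i+j≡n = begin
  sum (λ p → sumCode (λ c → χ (lookup q p ∷ permute c (removeAt q p))))
    ≡⟨ sum-cong-≗ (λ p → byFirst p (lookup q p) refl) ⟩
  sum (λ p → g (lookup q p))
    ≡⟨ sum-lookup q g ⟩
  ∣ q ∣ * g inside + ∣ ∁ q ∣ * g outside
    ≡⟨ cong₂ (λ a b → a * g inside + b * g outside) ∣q∣≡i ∣∁q∣≡j ⟩
  i * g inside + j * g outside
    ≡⟨ assemble i j i+j≡n ⟩
  i ! * j ! * levelSum (suc n) i χ ∎
  where
  open ≡-Reasoning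

  -- The values of `pred` at 0 are harmless: `assemble` multiplies the corresponding weight by 0.
  weight : ℕ → ℕ → Bool → ℕ
  weight i j inside  = pred i ! * j ! * levelSum n (pred i) (χ ∘ (inside ∷_))
  weight i j outside = i ! * pred j ! * levelSum n i (χ ∘ (outside ∷_))

  g : Bool → ℕ
  g = weight i j

  ∣∁q∣≡j : ∣ ∁ q ∣ ≡ j
  ∣∁q∣≡j = trans (∣∁p∣≡n∸∣p∣ q) (trans (cong₂ _∸_ (sym i+j≡n) ∣q∣≡i) (m+n∸m≡n i j))

  suc-pred-of : ∀ {m k} → m ≡ suc k → k ≡ pred m
  suc-pred-of refl = refl

  byFirst : ∀ p b → lookup q p ≡ b →
    sumCode (λ c → χ (lookup q p ∷ permute c (removeAt q p))) ≡ g (lookup q p)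
  byFirst p inside eq rewrite eq =
    sumCode-permute (removeAt q p) (pred i) j (χ ∘ (inside ∷_))
      (suc-pred-of i≡) (suc-injective (trans (cong (_+ j) (sym (trans i≡ (cong suc (suc-pred-of i≡))))) i+j≡n))
    where
    i≡ : i ≡ suc ∣ removeAt q p ∣
    i≡ = trans (sym ∣q∣≡i) (∣removeAt∣-inside q p eq)
  byFirst p outside eq rewrite eq = go j i+j≡n
    where
    i≡ : ∣ removeAt q p ∣ ≡ i
    i≡ = trans (sym (∣removeAt∣-outside q p eq)) ∣q∣≡i
    go : ∀ j → i + j ≡ suc n →
      sumCode (λ c → χ (outside ∷ permute c (removeAt q p))) ≡ weight i j outside
    go zero    i+0≡n = contradiction (subst (_≤ n) i≡ (∣p∣≤n (removeAt q p)))
                         (<⇒≱ (≤-reflexive (trans (sym i+0≡n) (+-identityʳ i))))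
    go (suc j) i+j≡n = sumCode-permute (removeAt q p) i j (χ ∘ (outside ∷_))
                         i≡ (suc-injective (trans (sym (+-suc i j)) i+j≡n))

  assemble : ∀ i j → i + j ≡ suc n →
    i * weight i j inside + j * weight i j outside ≡ i ! * j ! * levelSum (suc n) i χ
  assemble zero    (suc j) _  = ring (suc j) (j !) _
    where
    ring : ∀ a b l → a * ((b + 0) * l) ≡ (a * b + 0) * l
    ring = solve-∀
  assemble (suc i) zero    eq
    rewrite levelSum-> {n} {suc i} (χ ∘ (outside ∷_)) (≤-reflexive (trans (sym eq) (+-identityʳ (suc i)))) =
    ring (suc i) (i !) _
    where
    ring : ∀ a b l → a * (b * 1 * l) + 0 ≡ a * b * 1 * l
    ring = solve-∀
  assemble (suc i) (suc j) _  =
    ring (suc i) (suc j) (i !) (j !) (levelSum n (suc i) (χ ∘ (outside ∷_))) (levelSum n i (χ ∘ (inside ∷_)))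
    where
    ring : ∀ a b u v l m →
      a * (u * (b * v) * m) + b * (a * u * v * l) ≡ a * u * (b * v) * (l + m)
    ring = solve-∀

factorials-*-C : ∀ i j n → i + j ≡ n → i ! * j ! * (n C i) ≡ n !
factorials-*-C i j _ refl = begin
  i ! * j ! * ((i + j) C i)                         ≡⟨ cong (λ k → i ! * k ! * ((i + j) C i)) (m+n∸m≡n i j) ⟨
  i ! * (i + j ∸ i) ! * ((i + j) C i)               ≡⟨ cong (i ! * (i + j ∸ i) ! *_) (nCk≡n!/k![n-k]! i≤i+j) ⟩
  i ! * (i + j ∸ i) ! * ((i + j) ! / (i ! * (i + j ∸ i) !)) ≡⟨ m*[n/m]≡n (k![n∸k]!∣n! i≤i+j) ⟩
  (i + j) !                                         ∎
  where
  open ≡-Reasoning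
  i≤i+j = m≤m+n i j
  instance _ = i !* (i + j ∸ i) !≢0

-- The double chain.

-- Indices 2i and 2i − 1 stand for A_i and M_i of the identity permutation, for
-- 0 ≤ i < n and 0 < i < n respectively; index 2n − 1 stands for A_n = [n].  With
-- this numbering the size is ⌈u/2⌉ for all u < 2n.
doubleChain : ∀ n → ℕ → Subset n
doubleChain zero          _             = []
doubleChain (suc n)       zero          = ⊥
doubleChain (suc n)       (suc (suc u)) = inside ∷ doubleChain n u
doubleChain (suc zero)    (suc zero)    = inside ∷ []
doubleChain (suc (suc n)) (suc zero)    = outside ∷ inside ∷ ⊥

∣doubleChain∣ : ∀ n u → u < n * 2 → ∣ doubleChain n u ∣ ≡ ⌈ u /2⌉
∣doubleChain∣ (suc n)       zero          _ = ∣⊥∣≡0 (suc n)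
∣doubleChain∣ (suc zero)    (suc zero)    _ = refl
∣doubleChain∣ (suc (suc n)) (suc zero)    _ = cong suc (∣⊥∣≡0 n)
∣doubleChain∣ (suc n)       (suc (suc u)) (s≤s (s≤s u<2n)) = cong suc (∣doubleChain∣ n u u<2n)

doubleChain-injective : ∀ n {u v} → u < n * 2 → v < n * 2 →
  doubleChain n u ≡ doubleChain n v → u ≡ v
doubleChain-injective (suc n)             {zero}        {zero}        _ _ _  = refl
doubleChain-injective (suc (suc n))       {zero}        {suc zero}    _ _ ()
doubleChain-injective (suc zero)          {zero}        {suc zero}    _ _ ()
doubleChain-injective (suc n)             {zero}        {suc (suc v)} _ _ ()
doubleChain-injective (suc zero)          {suc zero}    {zero}        _ _ ()
doubleChain-injective (suc (suc n))       {suc zero}    {zero}        _ _ ()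
doubleChain-injective (suc n)             {suc zero}    {suc zero}    _ _ _  = refl
doubleChain-injective (suc zero)          {suc zero}    {suc (suc v)} _ (s≤s (s≤s ())) _
doubleChain-injective (suc (suc n))       {suc zero}    {suc (suc v)} _ _ ()
doubleChain-injective (suc n)             {suc (suc u)} {zero}        _ _ ()
doubleChain-injective (suc zero)          {suc (suc u)} {suc zero}    (s≤s (s≤s ())) _ _
doubleChain-injective (suc (suc n))       {suc (suc u)} {suc zero}    _ _ ()
doubleChain-injective (suc n)             {suc (suc u)} {suc (suc v)} (s≤s (s≤s u<)) (s≤s (s≤s v<)) eq =
  cong (2 +_) (doubleChain-injective n u< v< (∷-injectiveʳ eq))

-- Incomparable sets are at most two indices apart, the lower index being odd.
data _◁_ : ℕ → ℕ → Set where
  z◁  : ∀ {v} → 0 ◁ v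
  o◁  : ∀ {v} → 1 ◁ (4 + v)
  ss◁ : ∀ {u v} → u ◁ v → (2 + u) ◁ (2 + v)

-- Shifting both indices by 2 prepends a common element, which leaves only ∅ and M_1 = {2} as lower
-- sets; for n at least 2, every set from index 4 on contains both 1 and 2.
doubleChain-⊆ : ∀ n {u v} → u ◁ v → doubleChain n u ⊆ doubleChain n v
doubleChain-⊆ zero                z◁        = id
doubleChain-⊆ (suc n)             z◁        = ⊥⊆
doubleChain-⊆ zero                o◁        = id
doubleChain-⊆ (suc zero)          o◁        = id
doubleChain-⊆ (suc (suc n))       o◁        = out⊆ (in⊆in ⊥⊆)
doubleChain-⊆ zero                (ss◁ u◁v) = id
doubleChain-⊆ (suc n)             (ss◁ u◁v) = in⊆in (doubleChain-⊆ n u◁v)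

-- One more than the largest odd index not above w: after cutting the double
-- chain behind index w, the only sets below the cut that may fail to lie in
-- all sets above it have this odd index.
evenCeil : ℕ → ℕ
evenCeil zero          = 0
evenCeil (suc zero)    = 2
evenCeil (suc (suc w)) = 2 + evenCeil w

across-cut : ∀ {u w v} → u ≤ w → w < v → suc u ≢ evenCeil w → u ◁ v
across-cut {zero}        {w}           {v} _ _ _ = z◁
across-cut {suc zero}    {suc zero}    {v} _ _ u≢ = contradiction refl u≢
across-cut {suc zero}    {2}           {v} _ _ u≢ = contradiction refl u≢
across-cut {suc zero}    {suc (suc (suc w))} {suc (suc (suc (suc v)))} _ _ _ = o◁
across-cut {suc zero}    {suc (suc (suc w))} {3} _ (s≤s (s≤s (s≤s ()))) _
across-cut {suc zero}    {suc (suc (suc w))} {2} _ (s≤s (s≤s ())) _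
across-cut {suc zero}    {suc (suc (suc w))} {1} _ (s≤s ()) _
across-cut {suc (suc u)} {suc (suc w)} {suc (suc v)} (s≤s (s≤s u≤w)) (s≤s (s≤s w<v)) u≢ =
  ss◁ (across-cut u≤w w<v λ eq → u≢ (cong (2 +_) eq))
across-cut {suc (suc u)} {suc (suc w)} {suc zero} _ (s≤s ()) _
across-cut {suc (suc u)} {suc zero} (s≤s ()) _ _

-- Slots for the layers of the poset.

indicator : Bool → ℕ
indicator b = if b then 1 else 0

-- Lists the members of `S` below `N` in increasing order. Past the last of them `at` merely stays
-- strictly increasing, so that it can be compared at any argument.
enumerate : ∀ N (S : ℕ → Bool) → Σ (ℕ → ℕ) λ at →
  (∀ {i j} → i < j → at i < at j) ×
  (∀ {i} → i < sumTo N (indicator ∘ S) → at i < N × S (at i) ≡ true)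
enumerate zero    S = id , id , λ ()
enumerate (suc N) S with S 0 in S0 | enumerate N (S ∘ suc)
... | false | at , mono , good =
  suc ∘ at , s<s ∘ mono , λ i< → s<s (proj₁ (good i<)) , proj₂ (good i<)
... | true  | at , mono , good = at′ , mono′ , good′
  where
  at′ : ℕ → ℕ
  at′ zero    = 0
  at′ (suc i) = suc (at i)
  mono′ : ∀ {i j} → i < j → at′ i < at′ j
  mono′ {zero}  {suc j} _         = z<s
  mono′ {suc i} {suc j} (s≤s i<j) = s<s (mono i<j)
  good′ : ∀ {i} → i < suc (sumTo N (indicator ∘ S ∘ suc)) → at′ i < suc N × S (at′ i) ≡ true
  good′ {zero}  _         = z<s , S0
  good′ {suc i} (s≤s i<c) = s<s (proj₁ (good i<c)) , proj₂ (good i<c)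

below : (Fin p → ℕ) → ℕ → Subset p
below f m = tabulate λ x → does (f x <? m)

∈-below⁺ : (f : Fin p → ℕ) {m : ℕ} {x : Fin p} → f x < m → x ∈ˢ below f m
∈-below⁺ f {m} {x} fx<m =
  lookup⇒[]= x _ (trans (lookup∘tabulate _ x) (dec-true (f x <? m) fx<m))

∈-below⁻ : (f : Fin p → ℕ) {m : ℕ} {x : Fin p} → x ∈ˢ below f m → f x < m
∈-below⁻ f {m} {x} x∈ =
  <ᵇ⇒< (f x) m (subst T (trans (sym ([]=⇒lookup x∈)) (lookup∘tabulate _ x)) _)

below-mono : (f : Fin p → ℕ) {l m : ℕ} → l ≤ m → ∣ below f l ∣ ≤ ∣ below f m ∣
below-mono f l≤m = p⊆q⇒∣p∣≤∣q∣ λ x∈ → ∈-below⁺ f (<-≤-trans (∈-below⁻ f x∈) l≤m)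

module Layout (r : Fin p → Fin h) where

  rank : Fin p → ℕ
  rank x = toℕ (r x)

  -- Lexicographic by rank and then by element: a linear order in which every layer is an interval.
  key : Fin p → ℕ
  key x = toℕ (combine (r x) x)

  rank<⇒key< : ∀ {x y} → rank x < rank y → key x < key y
  rank<⇒key< {x} {y} = Fin.combine-monoˡ-< x y

  key-injective : ∀ {x y} → key x ≡ key y → x ≡ y
  key-injective {x} {y} eq = Fin.combine-injectiveʳ (r x) x (r y) y (Fin.toℕ-injective eq)

  key≤⇒rank≤ : ∀ {x y} → key x ≤ key y → rank x ≤ rank y
  key≤⇒rank≤ kx≤ky = ≮⇒≥ λ ry<rx → <⇒≱ (rank<⇒key< ry<rx) kx≤ky

  -- The layer of rank j occupies the slots firstSlot j, …, firstSlot (suc j) ∸ 1,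
  -- one more than it has elements.
  firstSlot : ℕ → ℕ
  firstSlot j = ∣ below rank j ∣ + j

  -- The place of `x` in the key order, plus one spare slot for each lower layer.
  base : Fin p → ℕ
  base x = ∣ below key (key x) ∣ + rank x

  firstSlot-mono : ∀ {i j} → i ≤ j → firstSlot i ≤ firstSlot j
  firstSlot-mono i≤j = +-mono-≤ (below-mono rank i≤j) i≤j

  firstSlot≤base : ∀ x → firstSlot (rank x) ≤ base x
  firstSlot≤base x = +-monoˡ-≤ (rank x) (p⊆q⇒∣p∣≤∣q∣ λ y∈ → ∈-below⁺ key (rank<⇒key< (∈-below⁻ rank y∈)))

  -- The element `x` itself makes the inclusion of segments strict, and the spare slot of its layer
  -- leaves room to move `base x` up by one.
  base<firstSlot : ∀ x → suc (base x) < firstSlot (suc (rank x))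
  base<firstSlot x = begin-strict
    suc (base x)                               ≡⟨ +-suc _ (rank x) ⟨
    ∣ below key (key x) ∣ + suc (rank x)       <⟨ +-monoˡ-< (suc (rank x)) (p⊂q⇒∣p∣<∣q∣ below-⊂) ⟩
    firstSlot (suc (rank x))                       ∎
    where
    open ≤-Reasoning
    below-⊂ : below key (key x) ⊂ below rank (suc (rank x))
    below-⊂ = (λ y∈ → ∈-below⁺ rank (s≤s (key≤⇒rank≤ (<⇒≤ (∈-below⁻ key y∈)))))
           , x , ∈-below⁺ rank ≤-refl , (λ x∈ → <-irrefl refl (∈-below⁻ key x∈))

  base-strict : ∀ {x y} → key x < key y → base x < base y
  base-strict {x} {y} kx<ky = +-mono-<-≤ (p⊂q⇒∣p∣<∣q∣ below-⊂) (key≤⇒rank≤ (<⇒≤ kx<ky))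
    where
    below-⊂ : below key (key x) ⊂ below key (key y)
    below-⊂ = (λ z∈ → ∈-below⁺ key (<-trans (∈-below⁻ key z∈) kx<ky))
           , x , ∈-below⁺ key kx<ky , (λ x∈ → <-irrefl refl (∈-below⁻ key x∈))

  firstSlot≤ : ∀ j → firstSlot j ≤ p + j
  firstSlot≤ j = +-monoˡ-≤ j (∣p∣≤n (below rank j))

-- Placing the poset along the double chain.

module Placement (r : Fin p → Fin h) (at : ℕ → ℕ) (at-mono : ∀ {i j} → i < j → at i < at j)
                 (c : ℕ) (p+h≤1+c : p + h ≤ suc c) where
  open Layout r

  at-injective : ∀ {i j} → at i ≡ at j → i ≡ j
  at-injective {i} {j} eq with <-cmp i j
  ... | tri< i<j _ _ = contradiction eq (<⇒≢ (at-mono i<j))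
  ... | tri≈ _ i≡j _ = i≡j
  ... | tri> _ _ j<i = contradiction (sym eq) (<⇒≢ (at-mono j<i))

  at-mono-≤ : ∀ {i j} → i ≤ j → at i ≤ at j
  at-mono-≤ i≤j = [ <⇒≤ ∘ at-mono , ≤-reflexive ∘ cong at ]′ (m≤n⇒m<n∨m≡n i≤j)

  -- Slots whose index is at least d - 1 move up by one, so the index d - 1 is never hit and order
  -- is kept. Storing the forbidden index plus one lets d = 0 forbid nothing.
  skip : ℕ → ℕ → ℕ
  skip d m with d ≤? suc (at m)
  ... | yes _ = suc m
  ... | no  _ = m

  skip-≥ : ∀ d m → m ≤ skip d m
  skip-≥ d m with d ≤? suc (at m)
  ... | yes _ = n≤1+n m
  ... | no  _ = ≤-refl

  skip-≤ : ∀ d m → skip d m ≤ suc m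
  skip-≤ d m with d ≤? suc (at m)
  ... | yes _ = ≤-refl
  ... | no  _ = n≤1+n m

  skip-avoids : ∀ d m → suc (at (skip d m)) ≢ d
  skip-avoids d m with d ≤? suc (at m)
  ... | yes d≤ = λ eq → <-irrefl (sym eq) (≤-<-trans d≤ (s<s (at-mono (n<1+n m))))
  ... | no  d≰ = λ eq → d≰ (≤-reflexive (sym eq))

  skip-id : ∀ d m → suc (at m) < d → skip d m ≡ m
  skip-id d m at< with d ≤? suc (at m)
  ... | yes d≤ = contradiction d≤ (<⇒≱ at<)
  ... | no  _  = refl

  skip-strict : ∀ d {l m} → l < m → skip d l < skip d m
  skip-strict d {l} {m} l<m with d ≤? suc (at l) | d ≤? suc (at m)
  ... | yes _  | yes _  = s<s l<m
  ... | no  _  | no  _  = l<m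
  ... | no  _  | yes _  = m<n⇒m<1+n l<m
  ... | yes d≤ | no  d≰ = contradiction (≤-trans d≤ (s≤s (<⇒≤ (at-mono l<m)))) d≰

  -- The odd index to be avoided by the layer of rank j, plus one; the topmost layer
  -- needs no spare slot.
  barrier : ℕ → ℕ
  barrier j with suc j <? h
  ... | yes _ = evenCeil (at (pred (firstSlot (suc j))))
  ... | no  _ = 2 + at c

  barrier-lower : ∀ j → suc j < h → barrier j ≡ evenCeil (at (pred (firstSlot (suc j))))
  barrier-lower j 1+j<h with suc j <? h
  ... | yes _ = refl
  ... | no ≮h = contradiction 1+j<h ≮h

  barrier-top : ∀ j → h ≤ suc j → barrier j ≡ 2 + at c
  barrier-top j h≤1+j with suc j <? h
  ... | yes <h = contradiction <h (≤⇒≯ h≤1+j)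
  ... | no _ = refl

  pos : Fin p → ℕ
  pos x = skip (barrier (rank x)) (base x)

  base≤pos : ∀ x → base x ≤ pos x
  base≤pos x = skip-≥ _ (base x)

  pos<firstSlot : ∀ x → pos x < firstSlot (suc (rank x))
  pos<firstSlot x = ≤-<-trans (skip-≤ _ (base x)) (base<firstSlot x)

  -- Different layers occupy disjoint ranges of slots; within a layer the barrier is the same and
  -- `skip` is strictly increasing.
  pos-strict : ∀ {x y} → key x < key y → pos x < pos y
  pos-strict {x} {y} kx<ky with m≤n⇒m<n∨m≡n (key≤⇒rank≤ (<⇒≤ kx<ky))
  ... | inj₁ rx<ry = <-≤-trans (pos<firstSlot x) (≤-trans (firstSlot-mono rx<ry) (≤-trans (firstSlot≤base y) (base≤pos y)))
  ... | inj₂ rx≡ry = subst (λ j → skip (barrier j) (base x) < pos y) (sym rx≡ry)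
                       (skip-strict (barrier (rank y)) (base-strict kx<ky))

  pos-injective : ∀ {x y} → pos x ≡ pos y → x ≡ y
  pos-injective {x} {y} eq with <-cmp (key x) (key y)
  ... | tri≈ _ kx≡ky _ = key-injective kx≡ky
  ... | tri< kx<ky _ _ = contradiction eq (<⇒≢ (pos-strict kx<ky))
  ... | tri> _ _ ky<kx = contradiction (sym eq) (<⇒≢ (pos-strict ky<kx))

  -- The layers have p + h slots in total, but the last one is the spare slot of the topmost layer.
  -- The barrier of that layer lies beyond all slots below `c`, so nothing there moves, and p + h -
  -- 1 slots suffice.
  pos<c : ∀ x → pos x < c
  pos<c x = [ lower , topmost ]′ (<-≤-connex (suc (rank x)) h)
    where
    open ≤-Reasoning
    lower : suc (rank x) < h → pos x < c
    lower 1+rx<h = s<s⁻¹ (begin-strict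
      suc (pos x)                   ≤⟨ pos<firstSlot x ⟩
      firstSlot (suc (rank x))      ≤⟨ firstSlot≤ (suc (rank x)) ⟩
      p + suc (rank x)              <⟨ +-monoʳ-< p 1+rx<h ⟩
      p + h                         ≤⟨ p+h≤1+c ⟩
      suc c                         ∎)
    base<c : base x < c
    base<c = s≤s⁻¹ (begin
      suc (suc (base x))            ≤⟨ base<firstSlot x ⟩
      firstSlot (suc (rank x))      ≤⟨ firstSlot≤ (suc (rank x)) ⟩
      p + suc (rank x)              ≤⟨ +-monoʳ-≤ p (Fin.toℕ<n (r x)) ⟩
      p + h                         ≤⟨ p+h≤1+c ⟩
      suc c                         ∎)
    topmost : h ≤ suc (rank x) → pos x < c
    topmost h≤1+rx = begin-strict
      pos x                         ≡⟨ cong (λ d → skip d (base x)) (barrier-top (rank x) h≤1+rx) ⟩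
      skip (2 + at c) (base x)      ≡⟨ skip-id (2 + at c) (base x) (s<s (m<n⇒m<1+n (at-mono base<c))) ⟩
      base x                        <⟨ base<c ⟩
      c                             ∎

  -- Cut the double chain behind the last slot of the layer of `x`. The barrier keeps `x` off the
  -- one index below the cut that could spoil comparability.
  pos-◁ : ∀ {x y} → rank x < rank y → at (pos x) ◁ at (pos y)
  pos-◁ {x} {y} rx<ry = across-cut
    (at-mono-≤ (pred-mono-≤ (pos<firstSlot x)))
    (at-mono (<-≤-trans pred< (≤-trans (firstSlot-mono rx<ry) (≤-trans (firstSlot≤base y) (base≤pos y)))))
    (λ eq → skip-avoids (barrier (rank x)) (base x)
      (trans eq (sym (barrier-lower (rank x) (≤-<-trans rx<ry (Fin.toℕ<n (r y)))))))
    where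
    pred< : pred (firstSlot (suc (rank x))) < firstSlot (suc (rank x))
    pred< with firstSlot (suc (rank x)) | pos<firstSlot x
    ... | suc s | _ = ≤-refl

-- Ranks in a finite poset.

-- Double-negation shift over a finite set. It supplies a decision procedure for the order of `P`
-- while a decidable, hence stable, inequality is being proved.
¬¬-Π : ∀ n {Q : Fin n → Set} → (∀ i → ¬ ¬ Q i) → ¬ ¬ (∀ i → Q i)
¬¬-Π zero    ¬¬Q ¬∀ = ¬∀ λ ()
¬¬-Π (suc n) ¬¬Q ¬∀ = ¬¬Q zero λ q₀ → ¬¬-Π n (¬¬Q ∘ suc) λ q →
  ¬∀ λ { zero → q₀ ; (suc i) → q i }

module Ranking (P : FinPoset) (_≤?P_ : ∀ x y → Dec (_≤P_ P x y)) where
  open IsPartialOrder (isPO P) using (antisym) renaming (refl to ≤P-refl; trans to ≤P-trans)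

  _<P_ : Fin (size P) → Fin (size P) → Set
  x <P y = _≤P_ P x y × x ≢ y

  _<?P_ : ∀ x y → Dec (x <P y)
  x <?P y = (x ≤?P y) ×-dec ¬? (x Fin.≟ y)

  -- A descending chain of `k` further elements starts at `x`; the largest such `k` serves as the
  -- rank of `x`.
  Tall : ℕ → Fin (size P) → Set
  Tall zero    x = ⊤
  Tall (suc k) x = ∃ λ y → y <P x × Tall k y

  tall? : ∀ k x → Dec (Tall k x)
  tall? zero    x = yes _
  tall? (suc k) x = Fin.any? λ y → (y <?P x) ×-dec tall? k y

  Tall-≤ : ∀ {k l x} → k ≤ l → Tall l x → Tall k x
  Tall-≤ z≤n       _               = _
  Tall-≤ (s≤s k≤l) (y , y<x , ty) = y , y<x , Tall-≤ k≤l ty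

  Tall⇒chain : ∀ k {x} → Tall k x →
    Σ (Fin (suc k) → Fin (size P)) λ c → IsChain P (suc k) c × (∀ i → _≤P_ P (c i) x)
  Tall⇒chain zero {x} _ = (λ _ → x) , ((λ { {zero} {zero} _ → refl }) , λ _ _ → inj₁ ≤P-refl) , λ _ → ≤P-refl
  Tall⇒chain (suc k) {x} (y , (y≤x , y≢x) , ty) with Tall⇒chain k ty
  ... | c , (c-inj , c-comp) , c≤y = c′ , (c′-inj , c′-comp) , c′≤x
    where
    c≤x : ∀ i → _≤P_ P (c i) x
    c≤x i = ≤P-trans (c≤y i) y≤x
    c≢x : ∀ i → c i ≢ x
    c≢x i ci≡x = y≢x (antisym y≤x (subst (λ z → _≤P_ P z y) ci≡x (c≤y i)))
    c′ : Fin (suc (suc k)) → Fin (size P)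
    c′ zero    = x
    c′ (suc i) = c i
    c′-inj : ∀ {i j} → c′ i ≡ c′ j → i ≡ j
    c′-inj {zero}  {zero}  _  = refl
    c′-inj {zero}  {suc j} eq = contradiction (sym eq) (c≢x j)
    c′-inj {suc i} {zero}  eq = contradiction eq (c≢x i)
    c′-inj {suc i} {suc j} eq = cong suc (c-inj eq)
    c′-comp : ∀ i j → _≤P_ P (c′ i) (c′ j) ⊎ _≤P_ P (c′ j) (c′ i)
    c′-comp zero    zero    = inj₁ ≤P-refl
    c′-comp zero    (suc j) = inj₂ (c≤x j)
    c′-comp (suc i) zero    = inj₁ (c≤x i)
    c′-comp (suc i) (suc j) = c-comp i j
    c′≤x : ∀ i → _≤P_ P (c′ i) x
    c′≤x zero    = ≤P-refl
    c′≤x (suc i) = c≤x i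

  tallest : ∀ b x → ¬ Tall b x → ∃ λ k → Tall k x × ¬ Tall (suc k) x
  tallest zero    x ¬tall = contradiction _ ¬tall
  tallest (suc b) x ¬tall with tall? b x
  ... | yes tall = b , tall , ¬tall
  ... | no  ¬t   = tallest b x ¬t

  -- A rank `k` comes with a chain of k + 1 elements, hence k < h. If x < y, putting `y` on top of a
  -- longest chain ending in `x` shows that `y` has larger rank.
  strictRank : IsHeight P h → Σ (Fin (size P) → Fin h) λ r →
    ∀ x y → x <P y → toℕ (r x) < toℕ (r y)
  strictRank {h} (_ , bounded) = r , r-strict
    where
    Tall⇒<h : ∀ {k x} → Tall k x → k < h
    Tall⇒<h {k} tall with Tall⇒chain k tall
    ... | c , chain , _ = bounded (suc k) c chain
    top : ∀ x → ∃ λ k → Tall k x × ¬ Tall (suc k) x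
    top x = tallest h x (<-irrefl refl ∘ Tall⇒<h)
    r : Fin (size P) → Fin h
    r x = fromℕ< (Tall⇒<h (proj₁ (proj₂ (top x))))
    r-strict : ∀ x y → x <P y → toℕ (r x) < toℕ (r y)
    r-strict x y x<y
      rewrite Fin.toℕ-fromℕ< (Tall⇒<h (proj₁ (proj₂ (top x))))
            | Fin.toℕ-fromℕ< (Tall⇒<h (proj₁ (proj₂ (top y)))) =
      ≰⇒> λ ky≤kx → proj₂ (proj₂ (top y)) (Tall-≤ (s≤s ky≤kx) (x , x<y , proj₁ (proj₂ (top x))))

-- Counting the family along double chains and by levels.

member : Family n → Subset n → Bool
member F q = does (DecMembership._∈?_ (≡-dec Bool._≟_) q F)

member⇒∈ : (F : Family n) (q : Subset n) → member F q ≡ true → q ∈ F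
member⇒∈ F q eq with DecMembership._∈?_ (≡-dec Bool._≟_) q F
... | yes q∈F = q∈F

χ : Family n → Subset n → ℕ
χ F q = indicator (member F q)

chainCount : Family n → Code n → ℕ
chainCount {n} F c = sumTo (n * 2) λ u → χ F (permute c (doubleChain n u))

-- With `at` listing the double chain members that lie in `F`, slot `pos x` yields the image of `x`;
-- a strict relation in `P` raises the rank and so becomes an inclusion.
many⇒ContainsP : (P : FinPoset) → (∀ x y → Dec (_≤P_ P x y)) → IsHeight P h →
  (F : Family n) (c : Code n) → size P + h ≤ suc (chainCount F c) → ContainsP P F
many⇒ContainsP {n = n} P _≤?P_ isHeight F c many
  with Ranking.strictRank P _≤?P_ isHeight | enumerate (n * 2) (λ u → member F (permute c (doubleChain n u)))
... | r , r-strict | at , at-mono , at-good = φ , φ-injective , φ-mono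
  where
  open Placement r at at-mono (chainCount F c) many
  open IsPartialOrder (isPO P) using () renaming (refl to ≤P-refl)
  image : Fin (size P) → Subset n
  image x = permute c (doubleChain n (at (pos x)))
  image∈F : ∀ x → image x ∈ F
  image∈F x = member⇒∈ F (image x) (proj₂ (at-good (pos<c x)))
  φ : Fin (size P) → Fin (length F)
  φ x = index (image∈F x)
  lookup-φ : ∀ x → List.lookup F (φ x) ≡ image x
  lookup-φ x = sym (lookup-index (image∈F x))
  φ-injective : ∀ {x y} → φ x ≡ φ y → x ≡ y
  φ-injective {x} {y} eq = pos-injective (at-injective (doubleChain-injective n
    (proj₁ (at-good (pos<c x))) (proj₁ (at-good (pos<c y)))
    (permute-injective c (trans (sym (lookup-φ x)) (trans (cong (List.lookup F) eq) (lookup-φ y))))))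
  image-mono : ∀ x y → _≤P_ P x y → image x ⊆ image y
  image-mono x y x≤y with x Fin.≟ y
  ... | yes refl = id
  ... | no  x≢y  = permute-mono-⊆ c (doubleChain-⊆ n (pos-◁ (r-strict x y (x≤y , x≢y))))
  φ-mono : ∀ x y → _≤P_ P x y → List.lookup F (φ x) ⊆ List.lookup F (φ y)
  φ-mono x y x≤y = subst₂ _⊆_ (sym (lookup-φ x)) (sym (lookup-φ y)) (image-mono x y x≤y)

chainCount-≤ : (P : FinPoset) → IsHeight P h → ∀ k → card P + h ≡ 2 * k →
  (F : Family n) → PFree P F → (c : Code n) → chainCount F c ≤ 2 * (k ∸ 1)
chainCount-≤ {h} P isHeight k p+h≡2k F P-free c = decidable-stable (chainCount F c ≤? 2 * (k ∸ 1)) λ ≰ →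
  ¬¬-Π (size P) (λ x → ¬¬-Π (size P) λ y → ¬¬-excluded-middle) λ _≤?P_ →
  P-free (many⇒ContainsP P _≤?P_ isHeight F c (≤-trans (≤-reflexive p+h≡2k) (bound k (≰⇒> ≰))))
  where
  -- More than 2k - 2 members are at least 2k - 1 = |P| + h(P) - 1; for k = 0 the claim is trivial
  -- despite the truncated subtraction.
  bound : ∀ k {m} → 2 * (k ∸ 1) < m → 2 * k ≤ suc m
  bound zero    _  = z≤n
  bound (suc k) lt = ≤-trans (≤-reflexive (*-suc 2 k)) (s≤s lt)

-- Counts in two ways the pairs of a permutation and an index `u` whose permuted set lies in `F`.
weighted-count : (F : Family n) → ∀ b → (∀ c → chainCount F c ≤ b) →
  sumTo (n * 2) (λ u → ⌈ u /2⌉ ! * (n ∸ ⌈ u /2⌉) ! * levelSum n ⌈ u /2⌉ (χ F)) ≤ n ! * b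
weighted-count {n} F b le = begin
  sumTo (n * 2) (λ u → ⌈ u /2⌉ ! * (n ∸ ⌈ u /2⌉) ! * levelSum n ⌈ u /2⌉ (χ F))
    ≡⟨ sumTo-cong (n * 2) (λ u u<2n → sumCode-permute (doubleChain n u) ⌈ u /2⌉ (n ∸ ⌈ u /2⌉) (χ F)
                                        (∣doubleChain∣ n u u<2n) (m+[n∸m]≡n (subst (_≤ n) (∣doubleChain∣ n u u<2n) (∣p∣≤n (doubleChain n u))))) ⟨
  sumTo (n * 2) (λ u → sumCode (λ c → χ F (permute c (doubleChain n u))))
    ≡⟨ sumTo-sumCode (n * 2) (λ u c → χ F (permute c (doubleChain n u))) ⟩
  sumCode (chainCount F)
    ≤⟨ sumCode-bounded b (chainCount F) le ⟩
  n ! * b ∎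
  where
  open ≤-Reasoning

-- By uniqueness the head is absent from the tail, so its indicator δ adds to that of the tail
-- without overlap.
length≤levelSums : (F : Family n) → Unique F →
  length F ≤ sumTo (suc n) (λ i → levelSum n i (χ F))
length≤levelSums {n} []      _           = z≤n
length≤levelSums {n} (A ∷ F) (A∉F ∷ unq) = begin
  1 + length F
    ≤⟨ +-mono-≤ one≤ (length≤levelSums F unq) ⟩
  sumTo (suc n) (λ i → levelSum n i δ) + sumTo (suc n) (λ i → levelSum n i (χ F))
    ≡⟨ sumTo-+ (suc n) (λ i → levelSum n i δ) (λ i → levelSum n i (χ F)) ⟨
  sumTo (suc n) (λ i → levelSum n i δ + levelSum n i (χ F))
    ≤⟨ sumTo-mono (suc n) (λ i _ → ≤-trans (≤-reflexive (sym (levelSum-+ n i δ (χ F)))) (levelSum-mono n i split)) ⟩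
  sumTo (suc n) (λ i → levelSum n i (χ (A ∷ F))) ∎
  where
  open ≤-Reasoning
  _≟ˢ_ : (p q : Subset n) → Dec (p ≡ q)
  _≟ˢ_ = ≡-dec Bool._≟_
  δ : Subset n → ℕ
  δ q = indicator (does (q ≟ˢ A))
  split : ∀ q → δ q + χ F q ≤ χ (A ∷ F) q
  split q with q ≟ˢ A | DecMembership._∈?_ _≟ˢ_ q F
  ... | yes refl | yes q∈F = contradiction q∈F (All.All¬⇒¬Any A∉F)
  ... | yes refl | no  _   = ≤-refl
  ... | no  _    | yes _   = ≤-refl
  ... | no  _    | no  _   = ≤-refl
  point : ∀ {n} (χ : Subset n → ℕ) B → χ B ≤ levelSum n ∣ B ∣ χ
  point χ []            = ≤-refl
  point {suc n} χ (inside ∷ B)  = ≤-trans (point (χ ∘ (inside ∷_)) B) (m≤n+m _ (levelSum n (suc ∣ B ∣) (χ ∘ (outside ∷_))))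
  point {suc n} χ (outside ∷ B) = ≤-trans (point (χ ∘ (outside ∷_)) B) (lower ∣ B ∣)
    where
    lower : ∀ i → levelSum n i (χ ∘ (outside ∷_)) ≤ levelSum (suc n) i χ
    lower zero    = ≤-refl
    lower (suc i) = m≤m+n _ _
  δA : δ A ≡ 1
  δA with A ≟ˢ A
  ... | yes _   = refl
  ... | no  A≢A = contradiction refl A≢A
  one≤ : 1 ≤ sumTo (suc n) (λ i → levelSum n i δ)
  one≤ = begin
    1                                        ≡⟨ δA ⟨
    δ A                                      ≤⟨ point δ A ⟩
    levelSum n ∣ A ∣ δ                       ≤⟨ term≤sumTo (suc n) (λ i → levelSum n i δ) ∣ A ∣ (s≤s (∣p∣≤n A)) ⟩
    sumTo (suc n) (λ i → levelSum n i δ)     ∎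

complementary-levels : (F : Family n) → Intersecting F → ∀ i j → i + j ≡ n →
  levelSum n i (χ F) + levelSum n j (χ F) ≤ n C i
complementary-levels {n} F intersecting i j i+j≡n = begin
  levelSum n i (χ F) + levelSum n j (χ F)             ≡⟨ cong (levelSum n i (χ F) +_) (levelSum-∁ n i j (χ F) i+j≡n) ⟨
  levelSum n i (χ F) + levelSum n i (χ F ∘ ∁)       ≡⟨ levelSum-+ n i (χ F) (χ F ∘ ∁) ⟨
  levelSum n i (λ q → χ F q + χ F (∁ q))          ≤⟨ levelSum-mono n i atMostOne ⟩
  levelSum n i (λ _ → 1)                      ≡⟨ levelSum-one n i ⟩
  n C i                                       ∎
  where
  open ≤-Reasoning
  atMostOne : ∀ q → χ F q + χ F (∁ q) ≤ 1
  atMostOne q with DecMembership._∈?_ (≡-dec Bool._≟_) q F | DecMembership._∈?_ (≡-dec Bool._≟_) (∁ q) F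
  ... | yes q∈F | yes ∁q∈F with intersecting q∈F ∁q∈F
  ...   | x , x∈ = contradiction (proj₁ (x∈p∩q⁻ q (∁ q) x∈)) (x∈∁p⇒x∉p (proj₂ (x∈p∩q⁻ q (∁ q) x∈)))
  atMostOne q | yes _ | no  _ = ≤-refl
  atMostOne q | no  _ | yes _ = ≤-refl
  atMostOne q | no  _ | no  _ = z≤n

-- The extremal level profile.

-- A fractional knapsack bound: a budget that just fills the `K` cheapest places buys most there. It
-- sums (θ - v)(B - X) ≥ 0 over the cheap places and (v - θ)X ≥ 0 over the others, rearranged to
-- avoid subtraction.
threshold : ∀ K r (v X B : ℕ → ℕ) θ .{{_ : NonZero θ}} →
  (∀ j → j < K → v j ≤ θ) → (∀ i → i < r → θ ≤ v (K + i)) → (∀ j → j < K → X j ≤ B j) →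
  sumTo (K + r) (λ j → v j * X j) ≤ sumTo K (λ j → v j * B j) →
  sumTo (K + r) X ≤ sumTo K B
threshold K r v X B θ v≤θ θ≤v X≤B weighted = *-cancelˡ-≤ θ (+-cancelʳ-≤ (sumTo K λ j → v j * B j) _ _ (begin
  θ * sumTo (K + r) X + sumTo K (λ j → v j * B j)
    ≡⟨ cong (_+ sumTo K λ j → v j * B j) (sumTo-*ˡ (K + r) θ X) ⟨
  sumTo (K + r) (λ j → θ * X j) + sumTo K (λ j → v j * B j)
    ≡⟨ cong (_+ sumTo K λ j → v j * B j) (sumTo-split K r (λ j → θ * X j)) ⟩
  sumTo K (λ j → θ * X j) + sumTo r (λ i → θ * X (K + i)) + sumTo K (λ j → v j * B j)
    ≡⟨ swap (sumTo K λ j → θ * X j) _ _ ⟩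
  sumTo K (λ j → θ * X j) + sumTo K (λ j → v j * B j) + sumTo r (λ i → θ * X (K + i))
    ≡⟨ cong (_+ sumTo r λ i → θ * X (K + i)) (sumTo-+ K (λ j → θ * X j) (λ j → v j * B j)) ⟨
  sumTo K (λ j → θ * X j + v j * B j) + sumTo r (λ i → θ * X (K + i))
    ≤⟨ +-mono-≤ (sumTo-mono K λ j j<K → rearrange (v≤θ j j<K) (X≤B j j<K))
                (sumTo-mono r λ i i<r → *-monoˡ-≤ (X (K + i)) (θ≤v i i<r)) ⟩
  sumTo K (λ j → θ * B j + v j * X j) + sumTo r (λ i → v (K + i) * X (K + i))
    ≡⟨ cong (_+ sumTo r λ i → v (K + i) * X (K + i)) (sumTo-+ K (λ j → θ * B j) (λ j → v j * X j)) ⟩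
  sumTo K (λ j → θ * B j) + sumTo K (λ j → v j * X j) + sumTo r (λ i → v (K + i) * X (K + i))
    ≡⟨ +-assoc (sumTo K λ j → θ * B j) _ _ ⟩
  sumTo K (λ j → θ * B j) + (sumTo K (λ j → v j * X j) + sumTo r (λ i → v (K + i) * X (K + i)))
    ≡⟨ cong₂ _+_ (sumTo-*ˡ K θ B) (sym (sumTo-split K r (λ j → v j * X j))) ⟩
  θ * sumTo K B + sumTo (K + r) (λ j → v j * X j)
    ≤⟨ +-monoʳ-≤ (θ * sumTo K B) weighted ⟩
  θ * sumTo K B + sumTo K (λ j → v j * B j) ∎))
  where
  open ≤-Reasoning
  swap : ∀ a b c → a + b + c ≡ a + c + b
  swap = solve-∀
  rearrange : ∀ {v x b} → v ≤ θ → x ≤ b → θ * x + v * b ≤ θ * b + v * x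
  rearrange {v} {x} {b} v≤θ x≤b = subst₂ (λ θ b → θ * x + v * b ≤ θ * b + v * x)
    (m+[n∸m]≡n v≤θ) (m+[n∸m]≡n x≤b)
    (≤-trans (m≤m+n _ ((θ ∸ v) * (b ∸ x))) (≤-reflexive (expand v x (θ ∸ v) (b ∸ x))))
    where
    expand : ∀ v x d e → (v + d) * x + v * (x + e) + d * e ≡ (v + d) * (x + e) + v * x
    expand = solve-∀

-- The levels t + 1 + j and t − j of [2t + 1] are complementary; a pair of them has
-- X j members of the family.  Every set lies in two of the summands of the double
-- chain count, except [n] and ∅, hence the smaller weight v t.
module Profile (t : ℕ) (x : ℕ → ℕ) where
  N : ℕ
  N = suc (t * 2)

  X W v B : ℕ → ℕ
  X j = x (suc t + j) + x (t ∸ j)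
  W j = (suc t + j) ! * (t ∸ j) !
  B j = N C (suc t + j)
  v j with j <? t
  ... | yes _ = 2 * W j
  ... | no  _ = W j

  v-< : ∀ {j} → j < t → v j ≡ 2 * W j
  v-< {j} j<t with j <? t
  ... | yes _  = refl
  ... | no ≮t = contradiction j<t ≮t

  v-top : v t ≡ W t
  v-top with t <? t
  ... | yes t<t = contradiction t<t (<-irrefl refl)
  ... | no  _   = refl

  W≢0 : ∀ j → NonZero (W j)
  W≢0 j = m*n≢0 ((suc t + j) !) ((t ∸ j) !) {{(suc t + j) !≢0}} {{(t ∸ j) !≢0}}

  v≢0 : ∀ j → NonZero (v j)
  v≢0 j with j <? t
  ... | yes _ = m*n≢0 2 (W j) {{_}} {{W≢0 j}}
  ... | no  _ = W≢0 j

  indices-sum : ∀ {j} → j ≤ t → (suc t + j) + (t ∸ j) ≡ N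
  indices-sum {j} j≤t = begin
    suc t + j + (t ∸ j)     ≡⟨ +-assoc (suc t) j (t ∸ j) ⟩
    suc t + (j + (t ∸ j))   ≡⟨ cong (suc t +_) (m+[n∸m]≡n j≤t) ⟩
    suc t + t               ≡⟨ double t ⟩
    N                       ∎
    where
    open ≡-Reasoning
    double : ∀ t → suc t + t ≡ suc (t * 2)
    double = solve-∀

  W*B : ∀ {j} → j ≤ t → W j * B j ≡ N !
  W*B {j} j≤t = factorials-*-C (suc t + j) (t ∸ j) N (indices-sum j≤t)

  -- Passing from `j` to j + 1 multiplies `W` by (t + j + 2)/(t - j).
  c*W≤W : ∀ {j} c → j < t → c * (t ∸ j) ≤ suc t + suc j → c * W j ≤ W (suc j)
  c*W≤W {j} c j<t le = begin
    c * ((suc t + j) ! * (t ∸ j) !)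
      ≡⟨ cong (λ s → c * ((suc t + j) ! * s !)) s≡ ⟩
    c * ((suc t + j) ! * (suc s * s !))
      ≡⟨ ring c ((suc t + j) !) (suc s) (s !) ⟩
    c * suc s * (suc t + j) ! * s !
      ≤⟨ *-monoˡ-≤ (s !) (*-monoˡ-≤ ((suc t + j) !) (≤-trans (≤-reflexive (cong (c *_) (sym s≡))) le)) ⟩
    (suc t + suc j) * (suc t + j) ! * s !
      ≡⟨ cong (_* s !) (trans (cong (_* (suc t + j) !) (+-suc (suc t) j)) (cong _! (sym (+-suc (suc t) j)))) ⟩
    (suc t + suc j) ! * s ! ∎
    where
    open ≤-Reasoning
    s = t ∸ suc j
    s≡ : t ∸ j ≡ suc s
    s≡ = +-∸-assoc 1 j<t
    ring : ∀ c a b d → c * (a * (b * d)) ≡ c * b * a * d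
    ring = solve-∀

  -- Only the last step loses the factor 2. There t - j = 1, so `W` grows by a factor of at least 2,
  -- which makes up for the loss.
  v-step : ∀ {j} → j < t → v j ≤ v (suc j)
  v-step {j} j<t = subst (_≤ v (suc j)) (sym (v-< j<t)) ([ lower , last ]′ (m≤n⇒m<n∨m≡n j<t))
    where
    open ≤-Reasoning
    lower : suc j < t → 2 * W j ≤ v (suc j)
    lower 1+j<t = begin
      2 * W j          ≤⟨ *-monoʳ-≤ 2 (≤-trans (≤-reflexive (sym (*-identityˡ (W j)))) (c*W≤W 1 j<t
                            (≤-trans (≤-reflexive (*-identityˡ (t ∸ j))) (≤-trans (m∸n≤m t j) (m≤n⇒m≤n+o (suc j) (n≤1+n t)))))) ⟩
      2 * W (suc j)    ≡⟨ v-< 1+j<t ⟨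
      v (suc j)        ∎
    last : suc j ≡ t → 2 * W j ≤ v (suc j)
    last refl = begin
      2 * W j          ≤⟨ c*W≤W 2 j<t (≤-trans (≤-reflexive (cong (2 *_) (m+n∸n≡m 1 j))) (s≤s (s≤s z≤n))) ⟩
      W (suc j)        ≡⟨ v-top ⟨
      v (suc j)        ∎

  v-mono : ∀ j i → j + i ≤ t → v j ≤ v (j + i)
  v-mono j zero    _  = ≤-reflexive (cong v (sym (+-identityʳ j)))
  v-mono j (suc i) le = begin
    v j               ≤⟨ v-mono j i (≤-trans (n≤1+n (j + i)) le′) ⟩
    v (j + i)         ≤⟨ v-step le′ ⟩
    v (suc (j + i))   ≡⟨ cong v (+-suc j i) ⟨
    v (j + suc i)     ∎
    where
    open ≤-Reasoning
    le′ : suc (j + i) ≤ t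
    le′ = subst (_≤ t) (+-suc j i) le

  y : ℕ → ℕ
  y i = i ! * (N ∸ i) ! * x i

  y-fold : ∀ j → j < suc t → y (suc t + j) + y (t ∸ j) ≡ W j * X j
  y-fold j (s≤s j≤t) = begin
    (suc t + j) ! * (N ∸ (suc t + j)) ! * x (suc t + j) + (t ∸ j) ! * (N ∸ (t ∸ j)) ! * x (t ∸ j)
      ≡⟨ cong₂ (λ a b → (suc t + j) ! * a ! * x (suc t + j) + (t ∸ j) ! * b ! * x (t ∸ j))
           (trans (cong (_∸ (suc t + j)) (sym (indices-sum j≤t))) (m+n∸m≡n (suc t + j) (t ∸ j)))
           (trans (cong (_∸ (t ∸ j)) (sym (indices-sum j≤t))) (m+n∸n≡m (suc t + j) (t ∸ j))) ⟩
    (suc t + j) ! * (t ∸ j) ! * x (suc t + j) + (t ∸ j) ! * (suc t + j) ! * x (t ∸ j)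
      ≡⟨ ring ((suc t + j) !) ((t ∸ j) !) (x (suc t + j)) (x (t ∸ j)) ⟩
    W j * X j ∎
    where
    open ≡-Reasoning
    ring : ∀ a b c d → a * b * c + b * a * d ≡ a * b * (c + d)
    ring = solve-∀

  adjacent-total : sumTo N (λ i → y i + y (suc i)) + (y N + y 0) ≡ 2 * sumTo (suc N) y
  adjacent-total = begin
    sumTo N (λ i → y i + y (suc i)) + (y N + y 0)
      ≡⟨ cong (_+ (y N + y 0)) (sumTo-+ N y (y ∘ suc)) ⟩
    sumTo N y + sumTo N (y ∘ suc) + (y N + y 0)
      ≡⟨ ring (sumTo N y) (sumTo N (y ∘ suc)) (y N) (y 0) ⟩
    (sumTo N y + y N) + (y 0 + sumTo N (y ∘ suc))
      ≡⟨ cong (_+ sumTo (suc N) y) (sumTo-last N y) ⟨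
    sumTo (suc N) y + sumTo (suc N) y
      ≡⟨ cong (sumTo (suc N) y +_) (+-identityʳ (sumTo (suc N) y)) ⟨
    2 * sumTo (suc N) y ∎
    where
    open ≡-Reasoning
    ring : ∀ a b c d → a + b + (c + d) ≡ (a + c) + (d + b)
    ring = solve-∀

  -- Adding y N + y 0 = W t · X t once more makes every level count twice; fold into complementary
  -- pairs, then cancel the added term.
  weighted-fold : sumTo (N * 2) (λ u → y ⌈ u /2⌉) ≡ sumTo (suc t) (λ j → v j * X j)
  weighted-fold = +-cancelʳ-≡ (W t * X t) _ _ (begin
    sumTo (N * 2) (λ u → y ⌈ u /2⌉) + W t * X t
      ≡⟨ cong₂ _+_ (sumTo-adjacent N y) (sym (trans (cong₂ (λ a b → y a + y b) N≡ (sym (n∸n≡0 t))) (y-fold t ≤-refl))) ⟩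
    sumTo N (λ i → y i + y (suc i)) + (y N + y 0)
      ≡⟨ adjacent-total ⟩
    2 * sumTo (suc N) y
      ≡⟨ cong (2 *_) (trans (sumTo-fold t y) (sumTo-cong (suc t) y-fold)) ⟩
    2 * sumTo (suc t) (λ j → W j * X j)
      ≡⟨ cong (2 *_) (sumTo-last t (λ j → W j * X j)) ⟩
    2 * (sumTo t (λ j → W j * X j) + W t * X t)
      ≡⟨ ring (sumTo t λ j → W j * X j) (W t * X t) ⟩
    2 * sumTo t (λ j → W j * X j) + W t * X t + W t * X t
      ≡⟨ cong (λ s → s + W t * X t + W t * X t) (sumTo-*ˡ t 2 (λ j → W j * X j)) ⟨
    sumTo t (λ j → 2 * (W j * X j)) + W t * X t + W t * X t
      ≡⟨ cong₂ (λ a b → a + b * X t + W t * X t)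
           (sumTo-cong t λ j j<t → trans (sym (*-assoc 2 (W j) (X j))) (cong (_* X j) (sym (v-< j<t))))
           (sym v-top) ⟩
    sumTo t (λ j → v j * X j) + v t * X t + W t * X t
      ≡⟨ cong (_+ W t * X t) (sumTo-last t (λ j → v j * X j)) ⟨
    sumTo (suc t) (λ j → v j * X j) + W t * X t ∎)
    where
    open ≡-Reasoning
    N≡ : N ≡ suc t + t
    N≡ = trans (sym (indices-sum ≤-refl)) (trans (cong (suc t + t +_) (n∸n≡0 t)) (+-identityʳ (suc t + t)))
    ring : ∀ a b → 2 * (a + b) ≡ 2 * a + b + b
    ring = solve-∀

  profile-bound : ∀ K → (∀ i j → i + j ≡ N → x i + x j ≤ N C i) →
    sumTo (N * 2) (λ u → y ⌈ u /2⌉) ≤ N ! * (2 * K) →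
    sumTo (suc N) x ≤ sumTo K B
  profile-bound K paired weighted =
    subst (_≤ sumTo K B) (sym (sumTo-fold t x)) ([ small , large ]′ (<-≤-connex K (suc t)))
    where
    open ≤-Reasoning
    X≤B : ∀ j → j < suc t → X j ≤ B j
    X≤B j (s≤s j≤t) = paired (suc t + j) (t ∸ j) (indices-sum j≤t)
    -- Here the bounds for the single pairs suffice, as the right side already includes all t + 1 of
    -- them.
    large : suc t ≤ K → sumTo (suc t) X ≤ sumTo K B
    large t<K = begin
      sumTo (suc t) X                 ≤⟨ sumTo-mono (suc t) X≤B ⟩
      sumTo (suc t) B                 ≤⟨ m≤m+n _ _ ⟩
      sumTo (suc t) B + sumTo (K ∸ suc t) (λ i → B (suc t + i)) ≡⟨ sumTo-split (suc t) (K ∸ suc t) B ⟨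
      sumTo (suc t + (K ∸ suc t)) B   ≡⟨ cong (λ k → sumTo k B) (m+[n∸m]≡n t<K) ⟩
      sumTo K B                       ∎
    -- The threshold is `v K`. As K ≤ t, the pairs j < K all have full weight and cost v j · B j = 2
    -- N! each, so the budget fills exactly these `K` pairs.
    small : K < suc t → sumTo (suc t) X ≤ sumTo K B
    small K<1+t = subst (λ m → sumTo m X ≤ sumTo K B) K+r≡
      (threshold K r v X B (v K) {{v≢0 K}} v≤vK vK≤v (λ j j<K → X≤B j (<-trans j<K K<1+t)) (begin
        sumTo (K + r) (λ j → v j * X j)     ≡⟨ cong (λ m → sumTo m (λ j → v j * X j)) K+r≡ ⟩
        sumTo (suc t) (λ j → v j * X j)     ≡⟨ weighted-fold ⟨
        sumTo (N * 2) (λ u → y ⌈ u /2⌉)     ≤⟨ weighted ⟩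
        N ! * (2 * K)                       ≡⟨ ring (N !) K ⟩
        K * (2 * N !)                       ≡⟨ sumTo-const K (2 * N !) ⟨
        sumTo K (λ _ → 2 * N !)             ≡⟨ sumTo-cong K (λ j j<K → vB (<-≤-trans j<K (s≤s⁻¹ K<1+t))) ⟨
        sumTo K (λ j → v j * B j)           ∎))
      where
      r = suc t ∸ K
      K+r≡ : K + r ≡ suc t
      K+r≡ = m+[n∸m]≡n (<⇒≤ K<1+t)
      ring : ∀ a K → a * (2 * K) ≡ K * (2 * a)
      ring = solve-∀
      vB : ∀ {j} → j < t → v j * B j ≡ 2 * N !
      vB {j} j<t = trans (cong (_* B j) (v-< j<t)) (trans (*-assoc 2 (W j) (B j)) (cong (2 *_) (W*B (<⇒≤ j<t))))
      v≤vK : ∀ j → j < K → v j ≤ v K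
      v≤vK j j<K = subst (λ k → v j ≤ v k) (m+[n∸m]≡n (<⇒≤ j<K))
        (v-mono j (K ∸ j) (≤-trans (≤-reflexive (m+[n∸m]≡n (<⇒≤ j<K))) (s≤s⁻¹ K<1+t)))
      vK≤v : ∀ i → i < r → v K ≤ v (K + i)
      vK≤v i i<r = v-mono K i (s≤s⁻¹ (≤-trans (+-monoʳ-< K i<r) (≤-reflexive K+r≡)))

-- The bound on the family.

half-odd : ∀ t → suc (t * 2) / 2 ≡ t
half-odd t = trans (+-distrib-/-∣ʳ 1 {t * 2} {2} (divides-refl t)) (m*n/n≡m t 2)

theorem12 : (P : FinPoset) (h : ℕ) → IsHeight P h →
    (n : ℕ) → 4 ≤ n → Σ ℕ (λ t → n ≡ 1 + 2 * t) →
    (k : ℕ) → card P + h ≡ 2 * k →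
    (F : Family n) → Unique F → Intersecting F → PFree P F →
    length F ≤ boundSum n k
theorem12 P h isHeight n 4≤n (t , n≡) k p+h≡2k F unique intersecting P-free
  with refl ← trans n≡ (cong suc (*-comm 2 t)) = begin
  length F
    ≤⟨ length≤levelSums F unique ⟩
  sumTo (suc n) (λ i → levelSum n i (χ F))
    -- The chain bound 2(k - 1) = |P| + h(P) - 2 is twice the number k - 1 of full levels in the
    -- extremal profile.
    ≤⟨ Profile.profile-bound t (λ i → levelSum n i (χ F)) (k ∸ 1) (complementary-levels F intersecting)
         (weighted-count F (2 * (k ∸ 1)) (chainCount-≤ P isHeight k p+h≡2k F P-free)) ⟩
  sumTo (k ∸ 1) (λ j → n C (suc t + j))
    ≡⟨ sumTo-cong (k ∸ 1) (λ j _ → cong (n C_) (trans (cong (_+ suc j) (half-odd t)) (+-suc t j))) ⟨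
  sumTo (k ∸ 1) (λ j → n C (n / 2 + suc j))
    ≡⟨ sumFrom1≡sumTo (k ∸ 1) (λ i → n C (n / 2 + i)) ⟨
  boundSum n k ∎
  where open ≤-Reasoning
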